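{- Let $C,D$ be complete lattices and let $s\dashv t:D\to C$ be a Galois connection between them. A complete lattice $X$ is isomorphic to $\mathrm{Fix}(ts)$ if, and only if, there exist sets $A,B$, $\bigvee$-dense maps $f:A\to X$, $k:A\to C$ and $\bigwedge$-dense maps $g:B\to X$, $h:B\to D$ such that for all $a\in A$ and all $b\in B$: $s(k(a))\leq h(b)$ in $D$ $\iff$ $f(a)\leq g(b)$ in $X$.
   Context: A Galois connection $s\dashv t:D\to C$ consists of monotone maps $s:C\to D$, $t:D\to C$ such that $s(x)\leq y\iff x\leq t(y)$ for all $x\in C$, $y\in D$. $\mathrm{Fix}(ts)=\{x\in C\mid x=ts(x)\}$, with the order inherited from $C$ (it is a complete lattice). A map $f:A\to Y$ from a set $A$ to a complete lattice $Y$ is $\bigvee$-dense (resp. $\bigwedge$-dense) if every $y\in Y$ is the join (resp. meet) $\bigvee_{i\in I}f(x_i)$ (resp. $\bigwedge_{i\in I}f(x_i)$) of some family $\{x_i\}_{i\in I}\subseteq A$ (possibly empty). -}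

module Defs where

open import Level using (Level; _⊔_; suc)
open import Data.Product using (Σ-syntax; _×_; proj₁)
open import Function.Base using (_∘_)
open import Relation.Binary.Bundles using (Poset)
open import Relation.Binary.Core using (_Preserves_⟶_)
open import Relation.Binary.Definitions using (Adjoint)
open import Relation.Binary.Morphism.Structures using (IsOrderIsomorphism)
import Relation.Binary.Construct.On as On

module _ {c ℓ₁ ℓ₂ i : Level} (P : Poset c ℓ₁ ℓ₂) where
  open Poset P

  IsJoin : {I : Set i} → (I → Carrier) → Carrier → Set (c ⊔ ℓ₂ ⊔ i)
  IsJoin x y = (∀ j → x j ≤ y) × (∀ z → (∀ j → x j ≤ z) → y ≤ z)

  IsMeet : {I : Set i} → (I → Carrier) → Carrier → Set (c ⊔ ℓ₂ ⊔ i)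
  IsMeet x y = (∀ j → y ≤ x j) × (∀ z → (∀ j → z ≤ x j) → z ≤ y)

-- Carrier, order and index sets share one universe, which plays the role of
-- the universe of sets: a family of elements may be indexed, for instance, by
-- the carrier itself or by {a | f a ≤ x}.  Equality of elements is the
-- poset's own equivalence _≈_.
record CompleteLattice (ℓ : Level) : Set (suc ℓ) where
  field
    poset : Poset ℓ ℓ ℓ

  open Poset poset public

  field
    ⋁        : {I : Set ℓ} → (I → Carrier) → Carrier
    ⋁-isJoin : {I : Set ℓ} (x : I → Carrier) → IsJoin poset x (⋁ x)
    ⋀        : {I : Set ℓ} → (I → Carrier) → Carrier
    ⋀-isMeet : {I : Set ℓ} (x : I → Carrier) → IsMeet poset x (⋀ x)

module _ {ℓ : Level} where
  open CompleteLattice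

  record GaloisConnection (C D : CompleteLattice ℓ) : Set ℓ where
    field
      s       : Carrier C → Carrier D
      t       : Carrier D → Carrier C
      s-mono  : s Preserves _≤_ C ⟶ _≤_ D
      t-mono  : t Preserves _≤_ D ⟶ _≤_ C
      adjoint : Adjoint (_≤_ C) (_≤_ D) s t

  -- Both the order and the equality of fixed points are those of the
  -- underlying elements of C; the fixedness proofs are ignored.
  Fix : {C D : CompleteLattice ℓ} → GaloisConnection C D → Poset ℓ ℓ ℓ
  Fix {C} G = On.poset {B = Σ[ x ∈ Carrier C ] (_≈_ C x (t (s x)))} (poset C) proj₁
    where open GaloisConnection G

  ⋁-Dense : {A : Set ℓ} (Y : CompleteLattice ℓ) → (A → Carrier Y) → Set (suc ℓ)
  ⋁-Dense {A} Y f =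
    ∀ y → Σ[ I ∈ Set ℓ ] Σ[ x ∈ (I → A) ] IsJoin (poset Y) (f ∘ x) y

  ⋀-Dense : {A : Set ℓ} (Y : CompleteLattice ℓ) → (A → Carrier Y) → Set (suc ℓ)
  ⋀-Dense {A} Y f =
    ∀ y → Σ[ I ∈ Set ℓ ] Σ[ x ∈ (I → A) ] IsMeet (poset Y) (f ∘ x) y

-- Order isomorphism; between complete lattices it automatically preserves
-- all joins and meets.
infix 4 _≅_
_≅_ : {ℓ : Level} → Poset ℓ ℓ ℓ → Poset ℓ ℓ ℓ → Set ℓ
P ≅ Q = Σ[ φ ∈ (P.Carrier → Q.Carrier) ]
          IsOrderIsomorphism P._≈_ Q._≈_ P._≤_ Q._≤_ φ
  where
  module P = Poset P
  module Q = Poset Q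

{-# OPTIONS --safe #-}
module Submission where

-- A join-dense map f : A → Y determines the order of Y: an element y is known
-- once it is known which f a lie below it, and dually for meet-dense maps.
-- Both directions rest on this.
--
-- Given an isomorphism φ : X → Fix(ts), take A = C and B = D with k and h the
-- identities, and let f c and g d be the preimages under φ of the fixed points
-- t (s c) and t d.  Both are surjective up to equality, hence dense, and
-- t (s a) ≤ t b is equivalent to s a ≤ b.
--
-- Conversely, given the four dense maps, send x to t (⋀ {h b | x ≤ g b}),
-- which is fixed because it lies in the image of t.  The compatibility
-- condition and the density of g give k a ≤ φ x ⇔ f a ≤ x, so the density of
-- f makes φ order-reflecting.  A fixed point c is the image of
-- x = ⋁ {f a | k a ≤ c}: the density of h gives f a ≤ x ⇔ k a ≤ c, so φ x and
-- c have the same k a below them, and the density of k makes them equal.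

open import Defs
open import Level using (Level; suc)
open import Data.Product using (Σ-syntax; _×_; _,_; proj₁; proj₂)
open import Data.Unit.Polymorphic using (⊤)
open import Function.Base using (id; _∘_)
open import Function.Bundles using (_⇔_; mk⇔; Equivalence)
open import Relation.Binary.Morphism.Structures using (IsOrderIsomorphism)

module _ {ℓ : Level} (Y : CompleteLattice ℓ) where
  open CompleteLattice Y

  -- A map with a section up to equality is dense: every element is the join,
  -- and the meet, of a one-element family.

  section⇒⋁-Dense : {A : Set ℓ} (f : A → Carrier) (σ : Carrier → A) →
                    (∀ y → f (σ y) ≈ y) → ⋁-Dense Y f
  section⇒⋁-Dense f σ fσ≈id y =
    ⊤ , (λ _ → σ y) , (λ _ → reflexive (fσ≈id y)) ,
    (λ z fσy≤z → trans (reflexive (Eq.sym (fσ≈id y))) (fσy≤z _))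

  section⇒⋀-Dense : {A : Set ℓ} (f : A → Carrier) (σ : Carrier → A) →
                    (∀ y → f (σ y) ≈ y) → ⋀-Dense Y f
  section⇒⋀-Dense f σ fσ≈id y =
    ⊤ , (λ _ → σ y) , (λ _ → reflexive (Eq.sym (fσ≈id y))) ,
    (λ z z≤fσy → trans (z≤fσy _) (reflexive (fσ≈id y)))

  ⋁-Dense⇒≤ : {A : Set ℓ} (f : A → Carrier) → ⋁-Dense Y f →
              ∀ {y z} → (∀ a → f a ≤ y → f a ≤ z) → y ≤ z
  ⋁-Dense⇒≤ f dense {y} {z} below with dense y
  ... | _ , x , ub , least = least z (λ i → below (x i) (ub i))

  ⋀-Dense⇒≤ : {A : Set ℓ} (f : A → Carrier) → ⋀-Dense Y f →
              ∀ {y z} → (∀ a → z ≤ f a → y ≤ f a) → y ≤ z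
  ⋀-Dense⇒≤ f dense {y} {z} above with dense z
  ... | _ , x , lb , greatest = greatest y (λ i → above (x i) (lb i))

module _ {ℓ : Level} {C D : CompleteLattice ℓ} (G : GaloisConnection C D) where
  private
    module C = CompleteLattice C
    module D = CompleteLattice D
  open GaloisConnection G

  transpose : ∀ {x y} → s x D.≤ y → x C.≤ t y
  transpose = proj₁ adjoint

  untranspose : ∀ {x y} → x C.≤ t y → s x D.≤ y
  untranspose = proj₂ adjoint

  unit : ∀ x → x C.≤ t (s x)
  unit x = transpose D.refl

  t-fixed : ∀ y → t y C.≈ t (s (t y))
  t-fixed y = C.antisym (unit (t y)) (t-mono (untranspose C.refl))

  -- The closure t (s x) is the least fixed point above x, so it lies below the
  -- fixed point t y exactly when x does, that is, when s x ≤ y.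
  closure≤t⇔ : ∀ {x y} → (s x D.≤ y) ⇔ (t (s x) C.≤ t y)
  closure≤t⇔ {x} = mk⇔ t-mono (λ tsx≤ty → untranspose (C.trans (unit x) tsx≤ty))

  module _ (X : CompleteLattice ℓ) where
    private module X = CompleteLattice X

    -- Dense maps from A into X and C and from B into X and D, under which the
    -- relation s x ≤ y between C and D becomes the order of X.
    DenseRepresentation : Set (suc ℓ)
    DenseRepresentation =
      Σ[ A ∈ Set ℓ ] Σ[ B ∈ Set ℓ ]
      Σ[ f ∈ (A → X.Carrier) ] Σ[ k ∈ (A → C.Carrier) ]
      Σ[ g ∈ (B → X.Carrier) ] Σ[ h ∈ (B → D.Carrier) ]
        (⋁-Dense X f × ⋁-Dense C k × ⋀-Dense X g × ⋀-Dense D h ×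
         (∀ (a : A) (b : B) → ((s (k a)) D.≤ (h b)) ⇔ ((f a) X.≤ (g b))))

    iso⇒dense : X.poset ≅ Fix G → DenseRepresentation
    iso⇒dense (φ , iso) =
      C.Carrier , D.Carrier , f , id , g , id ,
      section⇒⋁-Dense X f (proj₁ ∘ φ)
        (λ x → injective (C.Eq.trans (φf _) (C.Eq.sym (proj₂ (φ x))))) ,
      section⇒⋁-Dense C id id (λ _ → C.Eq.refl) ,
      section⇒⋀-Dense X g (s ∘ proj₁ ∘ φ)
        (λ x → injective (C.Eq.trans (φg _) (C.Eq.sym (proj₂ (φ x))))) ,
      section⇒⋀-Dense D id id (λ _ → D.Eq.refl) ,
      λ a b → mk⇔
        (λ sa≤b → cancel
          (C.trans (C.reflexive (φf a))
            (C.trans (to sa≤b) (C.reflexive (C.Eq.sym (φg b))))))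
        (λ fa≤gb → from
          (C.trans (C.reflexive (C.Eq.sym (φf a)))
            (C.trans (mono fa≤gb) (C.reflexive (φg b)))))
      where
      open IsOrderIsomorphism iso
      open module E {x} {y} = Equivalence (closure≤t⇔ {x} {y}) using (to; from)

      g : D.Carrier → X.Carrier
      g d = proj₁ (surjective (t d , t-fixed d))

      φg : ∀ d → proj₁ (φ (g d)) C.≈ t d
      φg d = proj₂ (surjective (t d , t-fixed d)) X.Eq.refl

      f : C.Carrier → X.Carrier
      f c = g (s c)

      φf : ∀ c → proj₁ (φ (f c)) C.≈ t (s c)
      φf c = φg (s c)

    dense⇒iso : DenseRepresentation → X.poset ≅ Fix G
    dense⇒iso (A , B , f , k , g , h , f-dense , k-dense , g-dense , h-dense , compat) =
      (λ x → φ x , t-fixed _) , record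
        { isOrderMonomorphism = record
          { isOrderHomomorphism = record { cong = φ-cong ; mono = φ-mono }
          ; injective = λ φx≈φy → X.antisym
              (φ-cancel (C.reflexive φx≈φy))
              (φ-cancel (C.reflexive (C.Eq.sym φx≈φy)))
          ; cancel = φ-cancel
          }
        ; surjective = λ (c , c-fixed) →
            preimage c , λ z≈x → C.Eq.trans (φ-cong z≈x) (φ-preimage c c-fixed)
        }
      where
      open module E {a} {b} = Equivalence (compat a b) using (to; from)

      -- The meet of the t (h b) with x ≤ g b, written as a value of t so that it
      -- is visibly a fixed point.
      φ : X.Carrier → C.Carrier
      φ x = t (D.⋀ {I = Σ[ b ∈ B ] x X.≤ g b} (h ∘ proj₁))

      f≤⇒k≤φ : ∀ {a x} → f a X.≤ x → k a C.≤ φ x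
      f≤⇒k≤φ fa≤x = transpose
        (proj₂ (D.⋀-isMeet _) _ (λ (b , x≤gb) → from (X.trans fa≤x x≤gb)))

      k≤φ⇒f≤ : ∀ {a x} → k a C.≤ φ x → f a X.≤ x
      k≤φ⇒f≤ ka≤φx = ⋀-Dense⇒≤ X g g-dense
        (λ b x≤gb → to (D.trans (untranspose ka≤φx) (proj₁ (D.⋀-isMeet _) (b , x≤gb))))

      φ-mono : ∀ {x y} → x X.≤ y → φ x C.≤ φ y
      φ-mono x≤y = ⋁-Dense⇒≤ C k k-dense
        (λ a ka≤φx → f≤⇒k≤φ (X.trans (k≤φ⇒f≤ ka≤φx) x≤y))

      φ-cancel : ∀ {x y} → φ x C.≤ φ y → x X.≤ y
      φ-cancel φx≤φy = ⋁-Dense⇒≤ X f f-dense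
        (λ a fa≤x → k≤φ⇒f≤ (C.trans (f≤⇒k≤φ fa≤x) φx≤φy))

      φ-cong : ∀ {x y} → x X.≈ y → φ x C.≈ φ y
      φ-cong x≈y = C.antisym (φ-mono (X.reflexive x≈y))
                             (φ-mono (X.reflexive (X.Eq.sym x≈y)))

      -- The inverse of φ at a fixed point c.
      preimage : C.Carrier → X.Carrier
      preimage c = X.⋁ {I = Σ[ a ∈ A ] k a C.≤ c} (f ∘ proj₁)

      k≤⇒f≤preimage : ∀ {a c} → k a C.≤ c → f a X.≤ preimage c
      k≤⇒f≤preimage ka≤c = proj₁ (X.⋁-isJoin _) (_ , ka≤c)

      preimage≤g : ∀ {c b} → s c D.≤ h b → preimage c X.≤ g b
      preimage≤g sc≤hb = proj₂ (X.⋁-isJoin _) _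
        (λ (a , ka≤c) → to (D.trans (s-mono ka≤c) sc≤hb))

      -- Since c = t (s c), the claim k a ≤ c amounts to s (k a) ≤ s c, which the
      -- density of h tests on the elements h b alone.
      f≤preimage⇒k≤ : ∀ {a c} → c C.≈ t (s c) → f a X.≤ preimage c → k a C.≤ c
      f≤preimage⇒k≤ c-fixed fa≤x = C.trans
        (transpose (⋀-Dense⇒≤ D h h-dense
          (λ b sc≤hb → from (X.trans fa≤x (preimage≤g sc≤hb)))))
        (C.reflexive (C.Eq.sym c-fixed))

      φ-preimage : ∀ c → c C.≈ t (s c) → φ (preimage c) C.≈ c
      φ-preimage c c-fixed = C.antisym
        (⋁-Dense⇒≤ C k k-dense (λ a ka≤φx → f≤preimage⇒k≤ c-fixed (k≤φ⇒f≤ ka≤φx)))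
        (⋁-Dense⇒≤ C k k-dense (λ a ka≤c → f≤⇒k≤φ (k≤⇒f≤preimage ka≤c)))

theorem1p2 : {ℓ : Level} (C D : CompleteLattice ℓ) (G : GaloisConnection C D) (X : CompleteLattice ℓ) →
    let module C = CompleteLattice C
        module D = CompleteLattice D
        module X = CompleteLattice X
        open GaloisConnection G
    in (X.poset ≅ Fix G)
       ⇔
       (Σ[ A ∈ Set ℓ ] Σ[ B ∈ Set ℓ ]
        Σ[ f ∈ (A → X.Carrier) ] Σ[ k ∈ (A → C.Carrier) ]
        Σ[ g ∈ (B → X.Carrier) ] Σ[ h ∈ (B → D.Carrier) ]
          (⋁-Dense X f × ⋁-Dense C k × ⋀-Dense X g × ⋀-Dense D h ×
           (∀ (a : A) (b : B) → ((s (k a)) D.≤ (h b)) ⇔ ((f a) X.≤ (g b)))))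
theorem1p2 C D G X = mk⇔ (iso⇒dense G X) (dense⇒iso G X)
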